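{- Let $i,j,k\ge 0$ be integers and let $D_{18}=\max\left\{\max\{i,j,k\},\left\lceil\frac{i+j+k}{2}\right\rceil\right\}$. Suppose that $D_{18}=\left\lceil\frac{i+j+k}{2}\right\rceil$ and denote this value by $\mathcal{L}$. Then the number $f_{18N}(i,j,k)$ of shortest paths from $q=(0,0,0)$ to $p=(i,j,k)$ in the 18-neighborhood of the cubic grid $\mathbb{Z}^3$ is $$f_{18N}(i,j,k)=\begin{cases}\dfrac{\mathcal{L}!}{(\mathcal{L}-i)!\,(\mathcal{L}-j)!\,(\mathcal{L}-k)!} & \text{if } i+j+k \text{ is even},\\[3mm] \dfrac{\mathcal{L}!\,\big((\mathcal{L}-i)(\mathcal{L}-j)+(\mathcal{L}-j)(\mathcal{L}-k)+(\mathcal{L}-k)(\mathcal{L}-i)\big)}{(\mathcal{L}-i)!\,(\mathcal{L}-j)!\,(\mathcal{L}-k)!} & \text{if } i+j+k \text{ is odd}.\end{cases}$$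
   Context: The cubic grid is $\mathbb{Z}^3$. For $r=(x_r,y_r,z_r)\in\mathbb{Z}^3$, its 18-neighborhood $N_{18}(r)$ is the set of points $s=(x_s,y_s,z_s)\in\mathbb{Z}^3$ with $\max\{|x_r-x_s|,|y_r-y_s|,|z_r-z_s|\}\le 1$ and $|x_r-x_s|+|y_r-y_s|+|z_r-z_s|\le 2$. A path of length $n$ from $q$ to $p$ in the 18-neighborhood is a sequence of points $q=r_0,r_1,\dots,r_n=p$ of $\mathbb{Z}^3$ with $r_{t+1}\in N_{18}(r_t)$ for $0\le t<n$. A shortest path is a path of minimal length among all paths from $q$ to $p$ in the given neighborhood; two paths are distinct if they differ as sequences of points. The quantity $D_{18}$ is the length of a shortest path from $(0,0,0)$ to $(i,j,k)$ in the 18-neighborhood. -}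

module Defs where

open import Data.Fin using (Fin; zero; suc; inject₁; fromℕ)
open import Data.Integer as ℤ using (ℤ; +_; ∣_∣)
open import Data.Nat using (ℕ; suc; _+_; _*_; _∸_; _⊔_; _≤_; _!; ⌈_/2⌉; NonZero)
open import Data.Nat.Properties using (_!≢0; _!*_!≢0; m*n≢0)
open import Data.Product using (Σ; ∃; _×_; _,_; proj₁)
open import Data.Rational as ℚ using (ℚ)
open import Data.Vec using (Vec; lookup)
open import Function.Bundles using (Bijection)
open import Level using (0ℓ)
open import Relation.Binary.Bundles using (Setoid)
import Relation.Binary.Construct.On as On
open import Relation.Binary.PropositionalEquality using (_≡_; setoid)

Point : Set
Point = ℤ × ℤ × ℤ

origin : Point
origin = + 0 , + 0 , + 0

-- The definition makes every point a member of its own neighborhood.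
_∈N₁₈_ : Point → Point → Set
(xₛ , yₛ , zₛ) ∈N₁₈ (xᵣ , yᵣ , zᵣ) =
  (dx ⊔ dy ⊔ dz ≤ 1) × (dx + dy + dz ≤ 2)
  where
  dx dy dz : ℕ
  dx = ∣ xᵣ ℤ.- xₛ ∣
  dy = ∣ yᵣ ℤ.- yₛ ∣
  dz = ∣ zᵣ ℤ.- zₛ ∣

-- (n , r) stands for the points r₀ , … , rₙ, so n counts steps, not points.
PointSequence : Set
PointSequence = ∃ λ n → Vec Point (suc n)

len : PointSequence → ℕ
len = proj₁

IsPath : Point → Point → PointSequence → Set
IsPath q p (n , r) =
  lookup r zero ≡ q ×
  lookup r (fromℕ n) ≡ p ×
  (∀ (t : Fin n) → lookup r (suc t) ∈N₁₈ lookup r (inject₁ t))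

IsShortestPath : Point → Point → PointSequence → Set
IsShortestPath q p s = IsPath q p s × (∀ s′ → IsPath q p s′ → len s ≤ len s′)

-- Two shortest paths are identified exactly when their underlying sequences
-- are equal; the proofs of being a shortest path are ignored.
ShortestPaths : Point → Point → Setoid 0ℓ 0ℓ
ShortestPaths q p =
  On.setoid {B = Σ PointSequence (IsShortestPath q p)} (setoid PointSequence) proj₁

HasCardinality : Setoid 0ℓ 0ℓ → ℕ → Set
HasCardinality S n = Bijection (setoid (Fin n)) S

D₁₈ : ℕ → ℕ → ℕ → ℕ
D₁₈ i j k = (i ⊔ j ⊔ k) ⊔ ⌈ i + j + k /2⌉

-- The formulas divide in ℚ, so no rounding is involved. Truncated subtraction
-- agrees with subtraction as long as i, j, k ≤ L, which follows when
-- D₁₈ i j k ≡ L.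
module _ (L i j k : ℕ) where

  denominator : ℕ
  denominator = (L ∸ i) ! * (L ∸ j) ! * (L ∸ k) !

  denominator≢0 : NonZero denominator
  denominator≢0 =
    m*n≢0 _ _ {{(L ∸ i) !* (L ∸ j) !≢0}} {{(L ∸ k) !≢0}}

  evenFormula : ℚ
  evenFormula = ℚ._/_ (+ (L !)) denominator {{denominator≢0}}

  oddFormula : ℚ
  oddFormula = ℚ._/_ (+ (L ! * ( (L ∸ i) * (L ∸ j)
                               + (L ∸ j) * (L ∸ k)
                               + (L ∸ k) * (L ∸ i))))
                     denominator {{denominator≢0}}

{-# OPTIONS --safe #-}

-- Let L = ⌈(i + j + k)/2⌉. A move raises x + y + z by at most 2, so a path takes at least L moves, and
-- a path of exactly L moves can waste at most 1 of the possible rise 2L. Hence each of its moves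
-- advances along two axes, except that exactly one move advances along a single axis when i + j + k is
-- odd. Such a path is a word in six letters; recording for each axis how many letters miss it, the path
-- ends at (i , j , k) iff these numbers are L ∸ i, L ∸ j, L ∸ k. Words with tally (a , b , c) are counted
-- by induction on their length n, removing the first letter: n!/(a! b! c!) of them when a + b + c = n,
-- and n! (ab + bc + ca)/(a! b! c!) when a + b + c = n + 1.

module Submission where

open import Defs
open import Data.Fin using (Fin; zero; suc; inject₁; fromℕ)
open import Data.Integer as ℤ using (ℤ; +_; -[1+_]; ∣_∣)
import Data.Integer.Properties as ℤ
import Data.Integer.Tactic.RingSolver as ℤ-Solver
open import Data.List using (List; []; _∷_; length; map; concatMap; cartesianProduct)
import Data.List as List
import Data.List.Membership.DecPropositional as DecMembership
open import Data.List.Membership.Propositional using (_∈_)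
open import Data.List.Membership.Propositional.Properties using (∈-map⁺; ∈-map⁻; ∈-cartesianProduct⁺; ∈-concatMap⁺; ∈-concatMap⁻; ∈-lookup)
open import Data.List.Properties using (length-++; length-map; map-cong)
open import Data.List.Relation.Unary.All as All using (All; []; _∷_)
import Data.List.Relation.Unary.All.Properties as All
open import Data.List.Relation.Unary.AllPairs as AllPairs using (AllPairs; []; _∷_)
import Data.List.Relation.Unary.AllPairs.Properties as AllPairs
open import Data.List.Relation.Unary.Any using (here; there; index; satisfied)
import Data.List.Relation.Unary.Any as Any
open import Data.List.Relation.Unary.Any.Properties using (lookup-index)
open import Data.List.Relation.Unary.Unique.Propositional using (Unique)
import Data.List.Relation.Unary.Unique.Propositional.Properties as Unique
open import Data.Nat using (ℕ; zero; suc; _+_; _*_; _∸_; _≤_; _<_; z≤n; s≤s; _!; ⌈_/2⌉; NonZero; ≢-nonZero⁻¹)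
import Data.Nat as ℕ
open import Data.Nat.ListAction using (sum)
open import Data.Nat.Divisibility using (_∣_; _∣?_; _∣0; ∣m∣n⇒∣m+n; ∣m+n∣m⇒∣n; ∣-refl; ∣1⇒≡1)
open import Data.Nat.Properties
open import Data.Nat.Tactic.RingSolver using (solve-∀)
open import Data.Product using (∃; _×_; _,_; proj₁; proj₂)
open import Data.Product.Properties using (≡-dec; ,-injectiveʳ-UIP)
open import Data.Rational using (_/_)
open import Data.Rational.Properties using (fromℚᵘ-cong)
open import Data.Rational.Unnormalised using (mkℚᵘ; *≡*)
open import Data.Sum using (_⊎_; inj₁; inj₂)
open import Data.Vec using (Vec; []; _∷_; lookup)
open import Data.Vec.Properties using (∷-injectiveˡ; ∷-injectiveʳ)
open import Function using (_∘_)
open import Relation.Binary.Definitions using (DecidableEquality)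
open import Relation.Binary.PropositionalEquality
open import Relation.Nullary using (¬_; Dec; yes; no; contradiction)
open import Relation.Nullary.Decidable using (from-yes; _→-dec_; _⊎-dec_)

-- Steps, words and tallies

Tally : Set
Tally = ℕ × ℕ × ℕ

-- The steps that can occur in a shortest path, named by the axes they advance along.
data Step : Set where
  e₂₃ e₁₃ e₁₂ e₁ e₂ e₃ : Step

steps : List Step
steps = e₂₃ ∷ e₁₃ ∷ e₁₂ ∷ e₁ ∷ e₂ ∷ e₃ ∷ []

∈-steps : ∀ s → s ∈ steps
∈-steps e₂₃ = here refl
∈-steps e₁₃ = there (here refl)
∈-steps e₁₂ = there (there (here refl))
∈-steps e₁  = there (there (there (here refl)))
∈-steps e₂  = there (there (there (there (here refl))))
∈-steps e₃  = there (there (there (there (there (here refl)))))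

steps-unique : Unique steps
steps-unique =
  ((λ ()) ∷ (λ ()) ∷ (λ ()) ∷ (λ ()) ∷ (λ ()) ∷ []) ∷
  ((λ ()) ∷ (λ ()) ∷ (λ ()) ∷ (λ ()) ∷ []) ∷
  ((λ ()) ∷ (λ ()) ∷ (λ ()) ∷ []) ∷
  ((λ ()) ∷ (λ ()) ∷ []) ∷
  ((λ ()) ∷ []) ∷
  [] ∷ []

displacement : Step → Point
displacement e₂₃ = + 0 , + 1 , + 1
displacement e₁₃ = + 1 , + 0 , + 1
displacement e₁₂ = + 1 , + 1 , + 0
displacement e₁  = + 1 , + 0 , + 0
displacement e₂  = + 0 , + 1 , + 0
displacement e₃  = + 0 , + 0 , + 1

-- Missed axes are recorded rather than advances, because the factorials of the resulting tally are
-- then those in the denominator of the formulas.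
misses : Step → Tally
misses e₂₃ = 1 , 0 , 0
misses e₁₃ = 0 , 1 , 0
misses e₁₂ = 0 , 0 , 1
misses e₁  = 0 , 1 , 1
misses e₂  = 1 , 0 , 1
misses e₃  = 1 , 1 , 0

infixr 6 _⊞_

_⊞_ : Tally → Tally → Tally
(a , b , c) ⊞ (a′ , b′ , c′) = a + a′ , b + b′ , c + c′

size : Tally → ℕ
size (a , b , c) = a + b + c

size-⊞ : ∀ t t′ → size (t ⊞ t′) ≡ size t + size t′
size-⊞ (a , b , c) (a′ , b′ , c′) = lemma a b c a′ b′ c′
  where
  lemma : ∀ a b c a′ b′ c′ → a + a′ + (b + b′) + (c + c′) ≡ a + b + c + (a′ + b′ + c′)
  lemma = solve-∀

tally : ∀ {n} → Vec Step n → Tally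
tally []      = 0 , 0 , 0
tally (s ∷ w) = misses s ⊞ tally w

-- f (t ∸ misses s), or d when misses s cannot be subtracted from t.
pop : {A : Set} → Step → A → (Tally → A) → Tally → A
pop e₂₃ d f (suc a , b , c)     = f (a , b , c)
pop e₁₃ d f (a , suc b , c)     = f (a , b , c)
pop e₁₂ d f (a , b , suc c)     = f (a , b , c)
pop e₁  d f (a , suc b , suc c) = f (a , b , c)
pop e₂  d f (suc a , b , suc c) = f (a , b , c)
pop e₃  d f (suc a , suc b , c) = f (a , b , c)
pop _   d f _                   = d

pop-⊞ : ∀ {A : Set} s (d : A) f t → pop s d f (misses s ⊞ t) ≡ f t
pop-⊞ e₂₃ d f t = refl
pop-⊞ e₁₃ d f t = refl
pop-⊞ e₁₂ d f t = refl
pop-⊞ e₁  d f t = refl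
pop-⊞ e₂  d f t = refl
pop-⊞ e₃  d f t = refl

-- The second case is uniform in the result type and the default, so one case split serves both
-- lists of words (default `[]`) and counts (default 0).
pop-view : ∀ s t → (∃ λ t′ → t ≡ misses s ⊞ t′) ⊎ (∀ {A : Set} (d : A) f → pop s d f t ≡ d)
pop-view e₂₃ (suc a , b , c)        = inj₁ (_ , refl)
pop-view e₂₃ (zero , b , c)         = inj₂ λ _ _ → refl
pop-view e₁₃ (a , suc b , c)        = inj₁ (_ , refl)
pop-view e₁₃ (a , zero , c)         = inj₂ λ _ _ → refl
pop-view e₁₂ (a , b , suc c)        = inj₁ (_ , refl)
pop-view e₁₂ (a , b , zero)         = inj₂ λ _ _ → refl
pop-view e₁  (a , suc b , suc c)    = inj₁ (_ , refl)
pop-view e₁  (a , zero , c)         = inj₂ λ _ _ → refl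
pop-view e₁  (a , suc b , zero)     = inj₂ λ _ _ → refl
pop-view e₂  (suc a , b , suc c)    = inj₁ (_ , refl)
pop-view e₂  (zero , b , c)         = inj₂ λ _ _ → refl
pop-view e₂  (suc a , b , zero)     = inj₂ λ _ _ → refl
pop-view e₃  (suc a , suc b , c)    = inj₁ (_ , refl)
pop-view e₃  (zero , b , c)         = inj₂ λ _ _ → refl
pop-view e₃  (suc a , zero , c)     = inj₂ λ _ _ → refl

length-pop : ∀ {A : Set} s (f : Tally → List A) t → length (pop s [] f t) ≡ pop s 0 (length ∘ f) t
length-pop s f t with pop-view s t
... | inj₁ (t′ , refl) = trans (cong length (pop-⊞ s [] f t′)) (sym (pop-⊞ s 0 _ t′))
... | inj₂ e           = trans (cong length (e [] f)) (sym (e 0 _))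

-- Listing the words of a given tally

startingWith : ∀ {n} → (Tally → List (Vec Step n)) → Tally → Step → List (Vec Step (suc n))
startingWith f t s = map (s ∷_) (pop s [] f t)

words : ∀ n → Tally → List (Vec Step n)
words zero    (zero , zero , zero)  = [] ∷ []
words zero    (zero , zero , suc _) = []
words zero    (zero , suc _ , _)    = []
words zero    (suc _ , _ , _)       = []
words (suc n) t                     = concatMap (startingWith (words n) t) steps

∈-words⁺ : ∀ {n} (w : Vec Step n) → w ∈ words n (tally w)
∈-words⁺ []      = here refl
∈-words⁺ {suc n} (s ∷ w) = ∈-concatMap⁺ (startingWith (words n) (tally (s ∷ w))) (Any.map member (∈-steps s))
  where
  member : ∀ {s′} → s ≡ s′ → (s ∷ w) ∈ startingWith (words n) (tally (s ∷ w)) s′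
  member refl = ∈-map⁺ (s ∷_) (subst (w ∈_) (sym (pop-⊞ s [] (words n) (tally w))) (∈-words⁺ w))

∈-words⁻ : ∀ {n} t {w : Vec Step n} → w ∈ words n t → tally w ≡ t
∈-words⁻ {zero}  (zero , zero , zero) {[]} _ = refl
∈-words⁻ {suc n} t w∈ with satisfied (∈-concatMap⁻ (startingWith (words n) t) {xs = steps} w∈)
... | s , w∈s with ∈-map⁻ (s ∷_) w∈s
...   | w′ , w′∈ , refl with pop-view s t
...     | inj₁ (t′ , refl) = cong (misses s ⊞_) (∈-words⁻ t′ (subst (w′ ∈_) (pop-⊞ s [] (words n) t′) w′∈))
...     | inj₂ e           with () ← subst (w′ ∈_) (e [] (words n)) w′∈

words-unique : ∀ n t → Unique (words n t)
words-unique zero    (zero , zero , zero)  = [] ∷ []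
words-unique zero    (zero , zero , suc _) = []
words-unique zero    (zero , suc _ , _)    = []
words-unique zero    (suc _ , _ , _)       = []
words-unique (suc n) t =
  Unique.concat⁺ (All.map⁺ {f = startingWith (words n) t}
                   (All.tabulate {xs = steps} λ {s} _ → Unique.map⁺ {f = s ∷_} ∷-injectiveʳ (pop-unique s)))
                 (AllPairs.map⁺ {f = startingWith (words n) t} (AllPairs.map disjoint steps-unique))
  where
  pop-unique : ∀ s → Unique (pop s [] (words n) t)
  pop-unique s with pop-view s t
  ... | inj₁ (t′ , refl) = subst Unique (sym (pop-⊞ s [] (words n) t′)) (words-unique n t′)
  ... | inj₂ e           = subst Unique (sym (e [] (words n))) []

  disjoint : ∀ {s s′} → s ≢ s′ →
             ∀ {w} → ¬ (w ∈ startingWith (words n) t s × w ∈ startingWith (words n) t s′)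
  disjoint s≢s′ (w∈ , w∈′) with ∈-map⁻ _ w∈ | ∈-map⁻ _ w∈′
  ... | _ , _ , refl | _ , _ , e = s≢s′ (∷-injectiveˡ e)

-- Counting words by recursion on the first letter

factorials : Tally → ℕ
factorials (a , b , c) = a ! * b ! * c !

-- When `misses s` can be removed from `t`, this is the quotient of `factorials t` by the factorials
-- of the remainder; otherwise it is 0.
weight : Step → Tally → ℕ
weight e₂₃ (a , b , c) = a
weight e₁₃ (a , b , c) = b
weight e₁₂ (a , b , c) = c
weight e₁  (a , b , c) = b * c
weight e₂  (a , b , c) = a * c
weight e₃  (a , b , c) = a * b

factorials-⊞ : ∀ s t → factorials (misses s ⊞ t) ≡ weight s (misses s ⊞ t) * factorials t
factorials-⊞ e₂₃ (a , b , c) = lemma (suc a) (a !) (b !) (c !)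
  where
  lemma : ∀ x u v w → x * u * v * w ≡ x * (u * v * w)
  lemma = solve-∀
factorials-⊞ e₁₃ (a , b , c) = lemma (suc b) (a !) (b !) (c !)
  where
  lemma : ∀ x u v w → u * (x * v) * w ≡ x * (u * v * w)
  lemma = solve-∀
factorials-⊞ e₁₂ (a , b , c) = lemma (suc c) (a !) (b !) (c !)
  where
  lemma : ∀ x u v w → u * v * (x * w) ≡ x * (u * v * w)
  lemma = solve-∀
factorials-⊞ e₁ (a , b , c) = lemma (suc b) (suc c) (a !) (b !) (c !)
  where
  lemma : ∀ x y u v w → u * (x * v) * (y * w) ≡ x * y * (u * v * w)
  lemma = solve-∀
factorials-⊞ e₂ (a , b , c) = lemma (suc a) (suc c) (a !) (b !) (c !)
  where
  lemma : ∀ x y u v w → x * u * v * (y * w) ≡ x * y * (u * v * w)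
  lemma = solve-∀
factorials-⊞ e₃ (a , b , c) = lemma (suc a) (suc b) (a !) (b !) (c !)
  where
  lemma : ∀ x y u v w → x * u * (y * v) * w ≡ x * y * (u * v * w)
  lemma = solve-∀

-- Multiplying a count by the factorials of its tally clears the denominators of the closed formulas.
scaledCount : ∀ n → Tally → ℕ
scaledCount n t = length (words n t) * factorials t

-- Splitting off the first letter `s` turns `factorials t` into `weight s t` times the factorials of
-- the remainder. The function `k` holds the expected scaled counts of the remainders and has to be
-- correct only on tallies that do arise.
scaledCount-suc : ∀ n t (k : Step → Tally → ℕ) →
  (∀ s t′ → t ≡ misses s ⊞ t′ → scaledCount n t′ ≡ k s t′) →
  scaledCount (suc n) t ≡ sum (map (λ s → weight s t * pop s 0 (k s) t) steps)
scaledCount-suc n t k hyp = begin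
  length (words (suc n) t) * factorials t
    ≡⟨ cong (_* factorials t) (length-words steps) ⟩
  sum (map (λ s → pop s 0 (length ∘ words n) t) steps) * factorials t
    ≡⟨ sum-*ʳ (λ s → pop s 0 (length ∘ words n) t) steps ⟩
  sum (map (λ s → pop s 0 (length ∘ words n) t * factorials t) steps)
    ≡⟨ cong sum (map-cong summand steps) ⟩
  sum (map (λ s → weight s t * pop s 0 (k s) t) steps) ∎
  where
  open ≡-Reasoning

  length-words : ∀ ss → length (concatMap (startingWith (words n) t) ss)
                      ≡ sum (map (λ s → pop s 0 (length ∘ words n) t) ss)
  length-words []       = refl
  length-words (s ∷ ss) = trans (length-++ (map (s ∷_) (pop s [] (words n) t)))
    (cong₂ _+_ (trans (length-map (s ∷_) (pop s [] (words n) t)) (length-pop s (words n) t)) (length-words ss))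

  sum-*ʳ : ∀ (f : Step → ℕ) {m} ss → sum (map f ss) * m ≡ sum (map (λ s → f s * m) ss)
  sum-*ʳ f     []       = refl
  sum-*ʳ f {m} (s ∷ ss) = trans (*-distribʳ-+ m (f s) _) (cong (_+_ (f s * m)) (sum-*ʳ f ss))

  summand : ∀ s → pop s 0 (length ∘ words n) t * factorials t ≡ weight s t * pop s 0 (k s) t
  summand s with pop-view s t
  ... | inj₂ e = trans (cong (_* factorials t) (e 0 _))
                       (sym (trans (cong (weight s t *_) (e 0 _)) (*-zeroʳ (weight s t))))
  ... | inj₁ (t′ , refl) = begin
    pop s 0 (length ∘ words n) t * factorials t        ≡⟨ cong₂ _*_ (pop-⊞ s 0 _ t′) (factorials-⊞ s t′) ⟩
    length (words n t′) * (weight s t * factorials t′) ≡⟨ lemma (length (words n t′)) (weight s t) (factorials t′) ⟩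
    weight s t * scaledCount n t′                      ≡⟨ cong (weight s t *_) (hyp s t′ refl) ⟩
    weight s t * k s t′                                ≡⟨ cong (weight s t *_) (pop-⊞ s 0 (k s) t′) ⟨
    weight s t * pop s 0 (k s) t                       ∎
    where
    lemma : ∀ x y z → x * (y * z) ≡ y * (x * z)
    lemma = solve-∀

weight-pop : ∀ s m t → weight s t * pop s 0 (λ _ → m) t ≡ weight s t * m
weight-pop e₂₃ m (zero , b , c)         = refl
weight-pop e₂₃ m (suc a , b , c)        = refl
weight-pop e₁₃ m (a , zero , c)         = refl
weight-pop e₁₃ m (a , suc b , c)        = refl
weight-pop e₁₂ m (a , b , zero)         = refl
weight-pop e₁₂ m (a , b , suc c)        = refl
weight-pop e₁  m (a , zero , c)         = refl
weight-pop e₁  m (a , suc b , zero)     = trans (*-zeroʳ (b * 0)) (cong (_* m) (sym (*-zeroʳ b)))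
weight-pop e₁  m (a , suc b , suc c)    = refl
weight-pop e₂  m (zero , b , c)         = refl
weight-pop e₂  m (suc a , b , zero)     = trans (*-zeroʳ (a * 0)) (cong (_* m) (sym (*-zeroʳ a)))
weight-pop e₂  m (suc a , b , suc c)    = refl
weight-pop e₃  m (zero , b , c)         = refl
weight-pop e₃  m (suc a , zero , c)     = trans (*-zeroʳ (a * 0)) (cong (_* m) (sym (*-zeroʳ a)))
weight-pop e₃  m (suc a , suc b , c)    = refl

pairs : Tally → ℕ
pairs (a , b , c) = a * b + b * c + c * a

-- Lowering `a` by one lowers `pairs` by `b + c`. The loss is added on the left, which avoids
-- truncated subtraction; at `a = 0` every term vanishes. The next two lemmas do the same for `b`
-- and `c`.
weight-pop-pairs₂₃ : ∀ m a b c → let t = a , b , c in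
  weight e₂₃ t * pop e₂₃ 0 (λ t′ → m * pairs t′) t + m * (a * (b + c)) ≡ m * (a * pairs t)
weight-pop-pairs₂₃ m zero    b c = refl
weight-pop-pairs₂₃ m (suc a) b c = lemma m a b c
  where
  lemma : ∀ m a b c → suc a * (m * (a * b + b * c + c * a)) + m * (suc a * (b + c))
                    ≡ m * (suc a * (suc a * b + b * c + c * suc a))
  lemma = solve-∀

weight-pop-pairs₁₃ : ∀ m a b c → let t = a , b , c in
  weight e₁₃ t * pop e₁₃ 0 (λ t′ → m * pairs t′) t + m * (b * (a + c)) ≡ m * (b * pairs t)
weight-pop-pairs₁₃ m a zero    c = refl
weight-pop-pairs₁₃ m a (suc b) c = lemma m a b c
  where
  lemma : ∀ m a b c → suc b * (m * (a * b + b * c + c * a)) + m * (suc b * (a + c))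
                    ≡ m * (suc b * (a * suc b + suc b * c + c * a))
  lemma = solve-∀

weight-pop-pairs₁₂ : ∀ m a b c → let t = a , b , c in
  weight e₁₂ t * pop e₁₂ 0 (λ t′ → m * pairs t′) t + m * (c * (a + b)) ≡ m * (c * pairs t)
weight-pop-pairs₁₂ m a b zero    = refl
weight-pop-pairs₁₂ m a b (suc c) = lemma m a b c
  where
  lemma : ∀ m a b c → suc c * (m * (a * b + b * c + c * a)) + m * (suc c * (a + b))
                    ≡ m * (suc c * (a * b + b * suc c + suc c * a))
  lemma = solve-∀

byAxes : {A : Set} → A → A → Step → A
byAxes two one e₂₃ = two
byAxes two one e₁₃ = two
byAxes two one e₁₂ = two
byAxes two one e₁  = one
byAxes two one e₂  = one
byAxes two one e₃  = one

size-misses : ∀ s → size (misses s) ≡ byAxes 1 2 s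
size-misses e₂₃ = refl
size-misses e₁₃ = refl
size-misses e₁₂ = refl
size-misses e₁  = refl
size-misses e₂  = refl
size-misses e₃  = refl

size-popped : ∀ {t} s t′ → t ≡ misses s ⊞ t′ → size t ≡ byAxes 1 2 s + size t′
size-popped s t′ refl = trans (size-⊞ (misses s) t′) (cong (_+ size t′) (size-misses s))

-- Every letter misses at least one axis, so a word of length `n` needs a tally of size at least
-- `n`. In the recursion each remainder is again too small.
scaledCount-short : ∀ n t → size t < n → scaledCount n t ≡ 0
scaledCount-short (suc n) t t<n = trans (scaledCount-suc n t (λ _ _ → 0) rest) (zeros t)
  where
  rest : ∀ s t′ → t ≡ misses s ⊞ t′ → scaledCount n t′ ≡ 0
  rest s t′ e = scaledCount-short n t′ (≤-pred (≤-trans (s≤s (smaller s (size-popped s t′ e))) t<n))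
    where
    smaller : ∀ s → size t ≡ byAxes 1 2 s + size t′ → suc (size t′) ≤ size t
    smaller e₂₃ e = ≤-reflexive (sym e)
    smaller e₁₃ e = ≤-reflexive (sym e)
    smaller e₁₂ e = ≤-reflexive (sym e)
    smaller e₁  e = ≤-trans (n≤1+n _) (≤-reflexive (sym e))
    smaller e₂  e = ≤-trans (n≤1+n _) (≤-reflexive (sym e))
    smaller e₃  e = ≤-trans (n≤1+n _) (≤-reflexive (sym e))

  zeros : ∀ t → sum (map (λ s → weight s t * pop s 0 (λ _ → 0) t) steps) ≡ 0
  zeros t = cong sum (map-cong (λ s → trans (weight-pop s 0 t) (*-zeroʳ (weight s t))) steps)

-- A one-axis first letter costs 2 of the size and leaves too little for `n` letters. The two-axis
-- letters contribute `a`, `b` and `c` times `n !`, where `a + b + c` is `suc n`.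
scaledCount-exact : ∀ n t → size t ≡ n → scaledCount n t ≡ n !
scaledCount-exact zero    (zero , zero , zero) refl = refl
scaledCount-exact (suc n) t@(a , b , c) eq = begin
  scaledCount (suc n) t
    ≡⟨ scaledCount-suc n t (λ s _ → k s) (λ s t′ e → rest s t′ (trans (sym eq) (size-popped s t′ e))) ⟩
  sum (map (λ s → weight s t * pop s 0 (λ _ → k s) t) steps)
    ≡⟨ cong sum (map-cong (λ s → weight-pop s (k s) t) steps) ⟩
  sum (map (λ s → weight s t * k s) steps)
    ≡⟨ lemma a b c (n !) ⟩
  (a + b + c) * n !
    ≡⟨ cong (_* n !) eq ⟩
  suc n ! ∎
  where
  open ≡-Reasoning

  k : Step → ℕ
  k = byAxes (n !) 0

  rest : ∀ s t′ → suc n ≡ byAxes 1 2 s + size t′ → scaledCount n t′ ≡ k s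
  rest e₂₃ t′ e = scaledCount-exact n t′ (suc-injective (sym e))
  rest e₁₃ t′ e = scaledCount-exact n t′ (suc-injective (sym e))
  rest e₁₂ t′ e = scaledCount-exact n t′ (suc-injective (sym e))
  rest e₁  t′ e = scaledCount-short n t′ (≤-reflexive (suc-injective (sym e)))
  rest e₂  t′ e = scaledCount-short n t′ (≤-reflexive (suc-injective (sym e)))
  rest e₃  t′ e = scaledCount-short n t′ (≤-reflexive (suc-injective (sym e)))

  lemma : ∀ a b c m → a * m + (b * m + (c * m + (b * c * 0 + (a * c * 0 + (a * b * 0 + 0))))) ≡ (a + b + c) * m
  lemma = solve-∀

-- A two-axis first letter leaves a remainder with the same excess 1, a one-axis first letter leaves
-- one without excess.
scaledCount-excess : ∀ n t → size t ≡ suc n → scaledCount n t ≡ n ! * pairs t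
-- The empty word does not have a tally of size 1, and `pairs` vanishes there too.
scaledCount-excess zero    (1 , zero , zero)    refl = refl
scaledCount-excess zero    (zero , 1 , zero)    refl = refl
scaledCount-excess zero    (zero , zero , 1)    refl = refl
-- The corrections `a * (b + c)`, `b * (a + c)`, `c * (a + b)` sum to `2 * pairs t`. Adding them to
-- both sides, and using that the one-axis letters contribute `n ! * pairs t`, makes the left side
-- `(n + 3) * (n ! * pairs t)`.
scaledCount-excess (suc n) t@(a , b , c) eq = +-cancelʳ-≡ (n ! * (2 * pairs t)) _ _ (begin
  scaledCount (suc n) t + n ! * (2 * pairs t)
    ≡⟨ cong (_+ n ! * (2 * pairs t))
            (scaledCount-suc n t k (λ s t′ e → rest s t′ (trans (sym eq) (size-popped s t′ e)))) ⟩
  x + (y + (z + (u e₁ + (u e₂ + (u e₃ + 0))))) + n ! * (2 * pairs t)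
    ≡⟨ cong (λ r → x + (y + (z + r)) + n ! * (2 * pairs t))
            (cong₂ _+_ (weight-pop e₁ (n !) t)
                       (cong₂ _+_ (weight-pop e₂ (n !) t) (cong (_+ 0) (weight-pop e₃ (n !) t)))) ⟩
  x + (y + (z + (b * c * n ! + (a * c * n ! + (a * b * n ! + 0))))) + n ! * (2 * pairs t)
    ≡⟨ regroup x y z a b c (n !) ⟩
  (x + n ! * (a * (b + c))) + (y + n ! * (b * (a + c))) + (z + n ! * (c * (a + b))) + n ! * pairs t
    ≡⟨ cong (_+ n ! * pairs t)
            (cong₂ _+_ (cong₂ _+_ (weight-pop-pairs₂₃ (n !) a b c) (weight-pop-pairs₁₃ (n !) a b c))
                       (weight-pop-pairs₁₂ (n !) a b c)) ⟩
  n ! * (a * pairs t) + n ! * (b * pairs t) + n ! * (c * pairs t) + n ! * pairs t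
    ≡⟨ collect (n !) (pairs t) a b c ⟩
  suc (a + b + c) * (n ! * pairs t)
    ≡⟨ cong (λ m → suc m * (n ! * pairs t)) eq ⟩
  suc (suc (suc n)) * (n ! * pairs t)
    ≡⟨ split n (n !) (pairs t) ⟩
  suc n ! * pairs t + n ! * (2 * pairs t) ∎)
  where
  open ≡-Reasoning

  k : Step → Tally → ℕ
  k = byAxes (λ t′ → n ! * pairs t′) (λ _ → n !)

  rest : ∀ s t′ → suc (suc n) ≡ byAxes 1 2 s + size t′ → scaledCount n t′ ≡ k s t′
  rest e₂₃ t′ e = scaledCount-excess n t′ (suc-injective (sym e))
  rest e₁₃ t′ e = scaledCount-excess n t′ (suc-injective (sym e))
  rest e₁₂ t′ e = scaledCount-excess n t′ (suc-injective (sym e))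
  rest e₁  t′ e = scaledCount-exact n t′ (suc-injective (suc-injective (sym e)))
  rest e₂  t′ e = scaledCount-exact n t′ (suc-injective (suc-injective (sym e)))
  rest e₃  t′ e = scaledCount-exact n t′ (suc-injective (suc-injective (sym e)))

  u : Step → ℕ
  u s = weight s t * pop s 0 (k s) t

  x y z : ℕ
  x = u e₂₃
  y = u e₁₃
  z = u e₁₂

  regroup : ∀ x y z a b c m →
    x + (y + (z + (b * c * m + (a * c * m + (a * b * m + 0))))) + m * (2 * (a * b + b * c + c * a)) ≡
    (x + m * (a * (b + c))) + (y + m * (b * (a + c))) + (z + m * (c * (a + b))) + m * (a * b + b * c + c * a)
  regroup = solve-∀

  collect : ∀ m p a b c → m * (a * p) + m * (b * p) + m * (c * p) + m * p ≡ suc (a + b + c) * (m * p)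
  collect = solve-∀

  split : ∀ n m p → suc (suc (suc n)) * (m * p) ≡ suc n * m * p + m * (2 * p)
  split = solve-∀

-- Moves in the grid and their effect on the coordinate sum

infixl 6 _⊹_

_⊹_ : Point → Point → Point
(x , y , z) ⊹ (dx , dy , dz) = x ℤ.+ dx , y ℤ.+ dy , z ℤ.+ dz

⟦_⟧ : Tally → Point
⟦ a , b , c ⟧ = + a , + b , + c

height : Point → ℤ
height (x , y , z) = x ℤ.+ y ℤ.+ z

height-⊹ : ∀ q d → height (q ⊹ d) ≡ height q ℤ.+ height d
height-⊹ (x , y , z) (dx , dy , dz) = lemma x y z dx dy dz
  where
  lemma : ∀ x y z dx dy dz →
    (x ℤ.+ dx) ℤ.+ (y ℤ.+ dy) ℤ.+ (z ℤ.+ dz) ≡ (x ℤ.+ y ℤ.+ z) ℤ.+ (dx ℤ.+ dy ℤ.+ dz)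
  lemma = ℤ-Solver.solve-∀

height-displacement : ∀ s → height (displacement s) ℤ.≤ + 2
height-displacement e₂₃ = ℤ.≤-refl
height-displacement e₁₃ = ℤ.≤-refl
height-displacement e₁₂ = ℤ.≤-refl
height-displacement e₁  = ℤ.+≤+ (s≤s z≤n)
height-displacement e₂  = ℤ.+≤+ (s≤s z≤n)
height-displacement e₃  = ℤ.+≤+ (s≤s z≤n)

displacement-injective : ∀ {s s′} → displacement s ≡ displacement s′ → s ≡ s′
displacement-injective {e₂₃} {e₂₃} _ = refl
displacement-injective {e₁₃} {e₁₃} _ = refl
displacement-injective {e₁₂} {e₁₂} _ = refl
displacement-injective {e₁}  {e₁}  _ = refl
displacement-injective {e₂}  {e₂}  _ = refl
displacement-injective {e₃}  {e₃}  _ = refl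

⊹-cancelˡ : ∀ q {d d′} → q ⊹ d ≡ q ⊹ d′ → d ≡ d′
⊹-cancelˡ (x , y , z) e = cong₂ _,_ (cancel x (cong proj₁ e))
  (cong₂ _,_ (cancel y (cong (proj₁ ∘ proj₂) e)) (cancel z (cong (proj₂ ∘ proj₂) e)))
  where
  cancel : ∀ u {v w} → u ℤ.+ v ≡ u ℤ.+ w → v ≡ w
  cancel u {v} {w} e = trans (sym (lemma u v)) (trans (cong (λ m → ℤ.- u ℤ.+ m) e) (lemma u w))
    where
    lemma : ∀ u v → ℤ.- u ℤ.+ (u ℤ.+ v) ≡ v
    lemma = ℤ-Solver.solve-∀

-- Neighborhood membership depends only on the difference vector, which leaves finitely many vectors
-- to classify.
IsMove : Point → Set
IsMove (dx , dy , dz) = (∣ dx ∣ ℕ.⊔ ∣ dy ∣ ℕ.⊔ ∣ dz ∣ ≤ 1) × (∣ dx ∣ + ∣ dy ∣ + ∣ dz ∣ ≤ 2)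

displacement-isMove : ∀ s → IsMove (displacement s)
displacement-isMove e₂₃ = s≤s z≤n , s≤s (s≤s z≤n)
displacement-isMove e₁₃ = s≤s z≤n , s≤s (s≤s z≤n)
displacement-isMove e₁₂ = s≤s z≤n , s≤s (s≤s z≤n)
displacement-isMove e₁  = s≤s z≤n , s≤s z≤n
displacement-isMove e₂  = s≤s z≤n , s≤s z≤n
displacement-isMove e₃  = s≤s z≤n , s≤s z≤n

∣i-[i+j]∣≡∣j∣ : ∀ i j → ∣ i ℤ.- (i ℤ.+ j) ∣ ≡ ∣ j ∣
∣i-[i+j]∣≡∣j∣ i j = trans (cong ∣_∣ (lemma i j)) (ℤ.∣-i∣≡∣i∣ j)
  where
  lemma : ∀ i j → i ℤ.- (i ℤ.+ j) ≡ ℤ.- j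
  lemma = ℤ-Solver.solve-∀

isMove⇒∈N₁₈ : ∀ q d → IsMove d → (q ⊹ d) ∈N₁₈ q
isMove⇒∈N₁₈ (x , y , z) (dx , dy , dz) move
  rewrite ∣i-[i+j]∣≡∣j∣ x dx | ∣i-[i+j]∣≡∣j∣ y dy | ∣i-[i+j]∣≡∣j∣ z dz = move

∈N₁₈⇒isMove : ∀ q q′ → q′ ∈N₁₈ q → ∃ λ d → IsMove d × q′ ≡ q ⊹ d
∈N₁₈⇒isMove (x , y , z) (x′ , y′ , z′) near
  rewrite ℤ.∣i-j∣≡∣j-i∣ x x′ | ℤ.∣i-j∣≡∣j-i∣ y y′ | ℤ.∣i-j∣≡∣j-i∣ z z′ =
  (x′ ℤ.- x , y′ ℤ.- y , z′ ℤ.- z) , near ,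
  cong₂ _,_ (lemma x x′) (cong₂ _,_ (lemma y y′) (lemma z z′))
  where
  lemma : ∀ x x′ → x′ ≡ x ℤ.+ (x′ ℤ.- x)
  lemma = ℤ-Solver.solve-∀

unitRange : List ℤ
unitRange = -[1+ 0 ] ∷ + 0 ∷ + 1 ∷ []

∈-unitRange : ∀ d → ∣ d ∣ ≤ 1 → d ∈ unitRange
∈-unitRange (-[1+ 0 ])     _        = here refl
∈-unitRange (+ 0)          _        = there (here refl)
∈-unitRange (+ 1)          _        = there (there (here refl))
∈-unitRange (+ suc (suc _)) (s≤s ())
∈-unitRange (-[1+ suc _ ]) (s≤s ())

_≟ᴾ_ : DecidableEquality Point
_≟ᴾ_ = ≡-dec ℤ._≟_ (≡-dec ℤ._≟_ ℤ._≟_)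

open DecMembership _≟ᴾ_ using (_∈?_)

-- Ranging over `unitCube` accounts for the bound on the maximum; the bound on the sum stays as a
-- decidable premise.
Classified : Point → Set
Classified d@(dx , dy , dz) =
  ∣ dx ∣ + ∣ dy ∣ + ∣ dz ∣ ≤ 2 → d ∈ map displacement steps ⊎ height d ℤ.≤ + 0

classified? : ∀ d → Dec (Classified d)
classified? d@(dx , dy , dz) =
  (∣ dx ∣ + ∣ dy ∣ + ∣ dz ∣ ≤? 2) →-dec (d ∈? map displacement steps ⊎-dec (height d ℤ.≤? + 0))

unitCube : List Point
unitCube = cartesianProduct unitRange (cartesianProduct unitRange unitRange)

-- Settled by evaluating the decision procedure on all 27 vectors.
unitCube-classified : All Classified unitCube
unitCube-classified = from-yes (All.all? classified? unitCube)

isMove⇒classified : ∀ d → IsMove d → d ∈ map displacement steps ⊎ height d ℤ.≤ + 0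
isMove⇒classified (dx , dy , dz) (max≤1 , sum≤2) = All.lookup unitCube-classified
  (∈-cartesianProduct⁺ (∈-unitRange dx (m⊔n≤o⇒m≤o _ ∣ dy ∣ dxy≤1))
    (∈-cartesianProduct⁺ (∈-unitRange dy (m⊔n≤o⇒n≤o ∣ dx ∣ _ dxy≤1))
                         (∈-unitRange dz (m⊔n≤o⇒n≤o (∣ dx ∣ ℕ.⊔ ∣ dy ∣) _ max≤1))))
  sum≤2
  where
  dxy≤1 : ∣ dx ∣ ℕ.⊔ ∣ dy ∣ ≤ 1
  dxy≤1 = m⊔n≤o⇒m≤o _ ∣ dz ∣ max≤1

classify-∈N₁₈ : ∀ q q′ → q′ ∈N₁₈ q → (∃ λ s → q′ ≡ q ⊹ displacement s) ⊎ height q′ ℤ.≤ height q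
classify-∈N₁₈ q q′ near with ∈N₁₈⇒isMove q q′ near
... | d , move , refl with isMove⇒classified d move
...   | inj₁ d∈         = inj₁ (let s , _ , e = ∈-map⁻ displacement {xs = steps} d∈ in s , cong (q ⊹_) e)
...   | inj₂ flat       = inj₂ (begin
  height (q ⊹ d)          ≡⟨ height-⊹ q d ⟩
  height q ℤ.+ height d   ≤⟨ ℤ.+-monoʳ-≤ (height q) flat ⟩
  height q ℤ.+ + 0        ≡⟨ ℤ.+-identityʳ (height q) ⟩
  height q                ∎)
  where open ℤ.≤-Reasoning

height-∈N₁₈ : ∀ q q′ → q′ ∈N₁₈ q → height q′ ℤ.≤ height q ℤ.+ + 2
height-∈N₁₈ q q′ near with classify-∈N₁₈ q q′ near
... | inj₁ (s , refl) = ℤ.≤-trans (ℤ.≤-reflexive (height-⊹ q (displacement s)))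
                                  (ℤ.+-monoʳ-≤ (height q) (height-displacement s))
... | inj₂ flat       = ℤ.≤-trans flat (ℤ.i≤i+j (height q) (+ 2))

-- Paths traced by words

Chained : ∀ {n} → Vec Point (suc n) → Set
Chained {n} r = ∀ (t : Fin n) → lookup r (suc t) ∈N₁₈ lookup r (inject₁ t)

last : ∀ {n} → Vec Point (suc n) → Point
last {n} r = lookup r (fromℕ n)

-- Each move raises the coordinate sum by at most 2. This gives the lower bound on the length and
-- also excludes moves that do not rise.
height-last : ∀ {n} q (r : Vec Point n) → Chained (q ∷ r) →
  height (last (q ∷ r)) ℤ.≤ height q ℤ.+ + (n * 2)
height-last {zero} q []          _     = ℤ.≤-reflexive (sym (ℤ.+-identityʳ _))
height-last {suc n} q (q′ ∷ r) chain = begin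
  height (last (q′ ∷ r))               ≤⟨ height-last q′ r (chain ∘ suc) ⟩
  height q′ ℤ.+ + (n * 2)              ≤⟨ ℤ.+-monoˡ-≤ (+ (n * 2)) (height-∈N₁₈ q q′ (chain zero)) ⟩
  height q ℤ.+ + 2 ℤ.+ + (n * 2)       ≡⟨ ℤ.+-assoc (height q) (+ 2) (+ (n * 2)) ⟩
  height q ℤ.+ + (suc n * 2)           ∎
  where open ℤ.≤-Reasoning

visited : ∀ {n} → Point → Vec Step n → Vec Point n
visited q []      = []
visited q (s ∷ w) = (q ⊹ displacement s) ∷ visited (q ⊹ displacement s) w

trace : ∀ {n} → Point → Vec Step n → Vec Point (suc n)
trace q w = q ∷ visited q w

trace-chained : ∀ {n} q (w : Vec Step n) → Chained (trace q w)
trace-chained q (s ∷ w) zero    = isMove⇒∈N₁₈ q (displacement s) (displacement-isMove s)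
trace-chained q (s ∷ w) (suc t) = trace-chained (q ⊹ displacement s) w t

trace-injective : ∀ {n} q {w w′ : Vec Step n} → trace q w ≡ trace q w′ → w ≡ w′
trace-injective q {[]}    {[]}      _ = refl
trace-injective q {s ∷ w} {s′ ∷ w′} e
  with refl ← displacement-injective {s} {s′} (⊹-cancelˡ q (∷-injectiveˡ (∷-injectiveʳ e))) =
  cong (s ∷_) (trace-injective (q ⊹ displacement s) (∷-injectiveʳ e))

-- One axis of the inductive step for `last-trace`: `d` is the gain of the first step on this axis
-- and `m` what it adds to the misses, together always 1.
coordinate : ∀ p q d m t n → p ℤ.+ t ≡ q ℤ.+ d ℤ.+ n → d ℤ.+ m ≡ + 1 → p ℤ.+ (m ℤ.+ t) ≡ q ℤ.+ (+ 1 ℤ.+ n)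
coordinate p q d m t n e complement = begin
  p ℤ.+ (m ℤ.+ t)         ≡⟨ swap p m t ⟩
  p ℤ.+ t ℤ.+ m           ≡⟨ cong (ℤ._+ m) e ⟩
  q ℤ.+ d ℤ.+ n ℤ.+ m     ≡⟨ regroup q d n m ⟩
  q ℤ.+ (d ℤ.+ m ℤ.+ n)   ≡⟨ cong (λ u → q ℤ.+ (u ℤ.+ n)) complement ⟩
  q ℤ.+ (+ 1 ℤ.+ n)       ∎
  where
  open ≡-Reasoning

  swap : ∀ p m t → p ℤ.+ (m ℤ.+ t) ≡ p ℤ.+ t ℤ.+ m
  swap = ℤ-Solver.solve-∀

  regroup : ∀ q d n m → q ℤ.+ d ℤ.+ n ℤ.+ m ≡ q ℤ.+ (d ℤ.+ m ℤ.+ n)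
  regroup = ℤ-Solver.solve-∀

displacement-misses : ∀ s → displacement s ⊹ ⟦ misses s ⟧ ≡ ⟦ 1 , 1 , 1 ⟧
displacement-misses e₂₃ = refl
displacement-misses e₁₃ = refl
displacement-misses e₁₂ = refl
displacement-misses e₁  = refl
displacement-misses e₂  = refl
displacement-misses e₃  = refl

advance : ∀ p q d m t n → p ⊹ ⟦ t ⟧ ≡ q ⊹ d ⊹ ⟦ n , n , n ⟧ → d ⊹ ⟦ m ⟧ ≡ ⟦ 1 , 1 , 1 ⟧ →
  p ⊹ ⟦ m ⊞ t ⟧ ≡ q ⊹ ⟦ suc n , suc n , suc n ⟧
advance (p₁ , p₂ , p₃) (q₁ , q₂ , q₃) (d₁ , d₂ , d₃) (m₁ , m₂ , m₃) (t₁ , t₂ , t₃) n e complement = cong₂ _,_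
  (coordinate p₁ q₁ d₁ (+ m₁) (+ t₁) (+ n) (cong proj₁ e) (cong proj₁ complement))
  (cong₂ _,_
    (coordinate p₂ q₂ d₂ (+ m₂) (+ t₂) (+ n) (cong (proj₁ ∘ proj₂) e) (cong (proj₁ ∘ proj₂) complement))
    (coordinate p₃ q₃ d₃ (+ m₃) (+ t₃) (+ n) (cong (proj₂ ∘ proj₂) e) (cong (proj₂ ∘ proj₂) complement)))

-- On each axis a step either advances by 1 or counts as a miss, so position and misses together
-- grow by 1 per step. Hence the tally determines the endpoint and conversely.
last-trace : ∀ {n} q (w : Vec Step n) → last (trace q w) ⊹ ⟦ tally w ⟧ ≡ q ⊹ ⟦ n , n , n ⟧
last-trace         q []      = refl
last-trace {suc n} q (s ∷ w) =
  advance (last (trace (q ⊹ displacement s) w)) q (displacement s) (misses s) (tally w) n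
          (last-trace (q ⊹ displacement s) w) (displacement-misses s)

-- A step that does not increase the height wastes 2 of the maximal rise 2n, more than the slack 1.
visited-surjective : ∀ {n} q (r : Vec Point n) → Chained (q ∷ r) →
  height q ℤ.+ + (n * 2) ℤ.≤ height (last (q ∷ r)) ℤ.+ + 1 → ∃ λ w → visited q w ≡ r
visited-surjective q []      _     _    = [] , refl
visited-surjective {suc n} q (q′ ∷ r) chain high with classify-∈N₁₈ q q′ (chain zero)
... | inj₁ (s , refl) = s ∷ proj₁ rest , cong (q′ ∷_) (proj₂ rest)
  where
  open ℤ.≤-Reasoning

  rest : ∃ λ w → visited q′ w ≡ r
  rest = visited-surjective q′ r (chain ∘ suc) (begin
    height q′ ℤ.+ + (n * 2)          ≤⟨ ℤ.+-monoˡ-≤ (+ (n * 2)) (height-∈N₁₈ q q′ (chain zero)) ⟩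
    height q ℤ.+ + 2 ℤ.+ + (n * 2)   ≡⟨ ℤ.+-assoc (height q) (+ 2) (+ (n * 2)) ⟩
    height q ℤ.+ + (suc n * 2)       ≤⟨ high ⟩
    height (last (q′ ∷ r)) ℤ.+ + 1   ∎)
... | inj₂ flat = contradiction (begin
    height q ℤ.+ + (n * 2) ℤ.+ + 2   ≡⟨ swap (height q) (+ 2) (+ (n * 2)) ⟨
    height q ℤ.+ + (suc n * 2)       ≤⟨ high ⟩
    height (last (q′ ∷ r)) ℤ.+ + 1   ≤⟨ ℤ.+-monoˡ-≤ (+ 1) (height-last q′ r (chain ∘ suc)) ⟩
    height q′ ℤ.+ + (n * 2) ℤ.+ + 1  ≤⟨ ℤ.+-monoˡ-≤ (+ 1) (ℤ.+-monoˡ-≤ (+ (n * 2)) flat) ⟩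
    height q ℤ.+ + (n * 2) ℤ.+ + 1   ∎)
  (ℤ.<⇒≱ (ℤ.+-monoʳ-< (height q ℤ.+ + (n * 2)) (ℤ.+<+ (s≤s (s≤s z≤n)))))
  where
  open ℤ.≤-Reasoning

  swap : ∀ h u v → h ℤ.+ (u ℤ.+ v) ≡ h ℤ.+ v ℤ.+ u
  swap = ℤ-Solver.solve-∀

-- Shortest paths as words with a prescribed tally

⊹-comm : ∀ q d → q ⊹ d ≡ d ⊹ q
⊹-comm (x , y , z) (dx , dy , dz) = cong₂ _,_ (ℤ.+-comm x dx) (cong₂ _,_ (ℤ.+-comm y dy) (ℤ.+-comm z dz))

⟦⟧-injective : ∀ {t t′} → ⟦ t ⟧ ≡ ⟦ t′ ⟧ → t ≡ t′
⟦⟧-injective refl = refl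

lookup-injective : ∀ {A : Set} {xs : List A} → Unique xs → ∀ {m n} → List.lookup xs m ≡ List.lookup xs n → m ≡ n
lookup-injective (x∉ ∷ _)  {zero}  {zero}  _ = refl
lookup-injective (x∉ ∷ _)  {zero}  {suc n} e = contradiction e (All.lookup x∉ (∈-lookup n))
lookup-injective (x∉ ∷ _)  {suc m} {zero}  e = contradiction (sym e) (All.lookup x∉ (∈-lookup m))
lookup-injective (_ ∷ xs!) {suc m} {suc n} e = cong suc (lookup-injective xs! e)

-- For either parity, `tight` bounds the waste of `L` moves by 1; the other hypotheses make the
-- subtractions in `missed` exact.
module _ {i j k L : ℕ} (i≤L : i ≤ L) (j≤L : j ≤ L) (k≤L : k ≤ L) (tight : L * 2 ≤ suc (i + j + k)) where

  private
    target : Point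
    target = ⟦ i , j , k ⟧

    missed : Tally
    missed = L ∸ i , L ∸ j , L ∸ k

    target-missed : target ⊹ ⟦ missed ⟧ ≡ ⟦ L , L , L ⟧
    target-missed = cong ⟦_⟧ (cong₂ _,_ (m+[n∸m]≡n i≤L) (cong₂ _,_ (m+[n∸m]≡n j≤L) (m+[n∸m]≡n k≤L)))

  tally⇒last : ∀ (w : Vec Step L) → tally w ≡ missed → last (trace origin w) ≡ target
  tally⇒last w e = ⊹-cancelˡ ⟦ missed ⟧ (begin
    ⟦ missed ⟧ ⊹ last (trace origin w)   ≡⟨ ⊹-comm ⟦ missed ⟧ (last (trace origin w)) ⟩
    last (trace origin w) ⊹ ⟦ missed ⟧   ≡⟨ cong (λ t → last (trace origin w) ⊹ ⟦ t ⟧) e ⟨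
    last (trace origin w) ⊹ ⟦ tally w ⟧  ≡⟨ last-trace origin w ⟩
    ⟦ L , L , L ⟧                        ≡⟨ target-missed ⟨
    target ⊹ ⟦ missed ⟧                  ≡⟨ ⊹-comm target ⟦ missed ⟧ ⟩
    ⟦ missed ⟧ ⊹ target                  ∎)
    where open ≡-Reasoning

  last⇒tally : ∀ (w : Vec Step L) → last (trace origin w) ≡ target → tally w ≡ missed
  last⇒tally w e = ⟦⟧-injective (⊹-cancelˡ target (begin
    target ⊹ ⟦ tally w ⟧                 ≡⟨ cong (_⊹ ⟦ tally w ⟧) e ⟨
    last (trace origin w) ⊹ ⟦ tally w ⟧  ≡⟨ last-trace origin w ⟩
    ⟦ L , L , L ⟧                        ≡⟨ target-missed ⟨
    target ⊹ ⟦ missed ⟧                  ∎))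
    where open ≡-Reasoning

  L≤len : ∀ s → IsPath origin target s → L ≤ len s
  -- Fewer than `L` moves would give 2n + 2 ≤ 2L ≤ i + j + k + 1 ≤ 2n + 1.
  L≤len (n , q ∷ r) (refl , r≡target , chain) = ≮⇒≥ λ n<L → 1+n≰n (begin
    suc n * 2            ≤⟨ *-monoˡ-≤ 2 n<L ⟩
    L * 2                ≤⟨ tight ⟩
    suc (i + j + k)      ≤⟨ s≤s (ℤ.drop‿+≤+ (subst (λ p → height p ℤ.≤ + (n * 2)) r≡target (height-last q r chain))) ⟩
    suc (n * 2)          ∎)
    where open ≤-Reasoning

  trace-isShortest : ∀ {w : Vec Step L} → w ∈ words L missed → IsShortestPath origin target (L , trace origin w)
  trace-isShortest {w} w∈ = (refl , tally⇒last w (∈-words⁻ missed w∈) , trace-chained origin w) , L≤len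

  -- By `tight` the path rises enough for `visited-surjective`, and its endpoint then fixes the
  -- tally of the word.
  shortest-isTrace : ∀ s → L ≡ len s → IsPath origin target s →
    ∃ λ w → w ∈ words L missed × (L , trace origin w) ≡ s
  shortest-isTrace (_ , q ∷ r) refl (refl , r≡target , chain)
    with w , refl ← visited-surjective q r chain
           (subst (λ p → + (L * 2) ℤ.≤ height p ℤ.+ + 1) (sym r≡target)
                  (ℤ.+≤+ (≤-trans tight (≤-reflexive (+-comm 1 (i + j + k)))))) =
    w , subst (λ t → w ∈ words L t) (last⇒tally w r≡target) (∈-words⁺ w) , refl

  -- The given word shows that the lower bound `L` on the length is attained.
  shortestPaths-cardinality : ∀ {w} → w ∈ words L missed →
    HasCardinality (ShortestPaths origin target) (length (words L missed))
  shortestPaths-cardinality w₀∈ = record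
    { to        = to
    ; cong      = λ { refl → refl }
    ; bijective = (λ e → lookup-injective (words-unique L missed)
                           -- Paths are dependent pairs over their length; uniqueness of equality
                           -- proofs in ℕ allows comparing the points at the common length `L`.
                           (trace-injective origin (,-injectiveʳ-UIP ≡-irrelevant e)))
                , surjective
    }
    where
    to : Fin (length (words L missed)) → ∃ (IsShortestPath origin target)
    to m = _ , trace-isShortest (∈-lookup m)

    surjective : ∀ (y : ∃ (IsShortestPath origin target)) → ∃ λ x → ∀ {z} → z ≡ x → proj₁ (to z) ≡ proj₁ y
    surjective (s , path , minimal)
      -- Minimality against the trace of the given word, together with `L≤len`, forces the length to
      -- be `L`.
      with w , w∈ , e ← shortest-isTrace s
             (≤-antisym (L≤len s path) (minimal (L , trace origin _) (proj₁ (trace-isShortest w₀∈)))) path =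
      index w∈ , λ { refl → trans (cong (λ w → L , trace origin w) (sym (lookup-index w∈))) e }

-- Parity, division in ℚ and the final count

⌈n/2⌉*2-even : ∀ n → 2 ∣ n → ⌈ n /2⌉ * 2 ≡ n
⌈n/2⌉*2-even zero          _     = refl
⌈n/2⌉*2-even (suc zero)    2∣1   with () ← ∣1⇒≡1 2∣1
⌈n/2⌉*2-even (suc (suc n)) 2∣2+n = cong (_+_ 2) (⌈n/2⌉*2-even n (∣m+n∣m⇒∣n 2∣2+n ∣-refl))

⌈n/2⌉*2-odd : ∀ n → ¬ 2 ∣ n → ⌈ n /2⌉ * 2 ≡ suc n
⌈n/2⌉*2-odd zero          2∤0   = contradiction (2 ∣0) 2∤0
⌈n/2⌉*2-odd (suc zero)    _     = refl
⌈n/2⌉*2-odd (suc (suc n)) 2∤2+n = cong (_+_ 2) (⌈n/2⌉*2-odd n (2∤2+n ∘ ∣m∣n⇒∣m+n ∣-refl))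

-- Both sides are normalised from unnormalised fractions, whose equality is cross multiplication.
/1≡/ : ∀ f m d .{{_ : NonZero d}} → f * d ≡ m → + f / 1 ≡ + m / d
/1≡/ f m (suc d) e = fromℚᵘ-cong {mkℚᵘ (+ f) 0} {mkℚᵘ (+ m) d} (*≡* (begin
  + f ℤ.* + suc d   ≡⟨ ℤ.pos-* f (suc d) ⟨
  + (f * suc d)     ≡⟨ cong +_ e ⟩
  + m               ≡⟨ ℤ.*-identityʳ (+ m) ⟨
  + m ℤ.* + 1       ∎))
  where open ≡-Reasoning

-- If two entries vanished, the third would be `suc L`, beyond its bound; two positive entries have
-- a positive product.
pairs≢0 : ∀ {L} a b c → a ≤ L → b ≤ L → c ≤ L → size (a , b , c) ≡ suc L → pairs (a , b , c) ≢ 0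
pairs≢0 zero    zero    c       a≤ b≤ c≤ refl _ = 1+n≰n c≤
pairs≢0 {L} zero (suc b) zero a≤ b≤ c≤ e _ = 1+n≰n (subst (_≤ L) (trans (sym (+-identityʳ (suc b))) e) b≤)
pairs≢0 zero    (suc b) (suc c) a≤ b≤ c≤ e    ()
pairs≢0 {L} (suc a) zero zero a≤ b≤ c≤ e _ =
  1+n≰n (subst (_≤ L) (trans (sym (trans (+-identityʳ _) (+-identityʳ (suc a)))) e) a≤)
pairs≢0 (suc a) zero    (suc c) a≤ b≤ c≤ e    p with () ← m+n≡0⇒n≡0 (a * 0 + 0) p
pairs≢0 (suc a) (suc b) c       a≤ b≤ c≤ e    ()

length*≢0⇒∃∈ : ∀ {A : Set} (xs : List A) {m} → length xs * m ≢ 0 → ∃ (_∈ xs)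
length*≢0⇒∃∈ []      ≢0 = contradiction refl ≢0
length*≢0⇒∃∈ (x ∷ _) _  = x , here refl

-- The shape `L + L * 2` lets `L * 2` be rewritten to the coordinate sum or its successor, after
-- which the coordinate sum cancels.
size-complement : ∀ {i j k L} → i ≤ L → j ≤ L → k ≤ L →
  size (L ∸ i , L ∸ j , L ∸ k) + (i + j + k) ≡ L + L * 2
size-complement {i} {j} {k} {L} i≤L j≤L k≤L = begin
  (L ∸ i) + (L ∸ j) + (L ∸ k) + (i + j + k)        ≡⟨ regroup (L ∸ i) (L ∸ j) (L ∸ k) i j k ⟩
  (L ∸ i + i) + (L ∸ j + j) + (L ∸ k + k)          ≡⟨ cong₂ _+_ (cong₂ _+_ (m∸n+n≡m i≤L) (m∸n+n≡m j≤L)) (m∸n+n≡m k≤L) ⟩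
  L + L + L                                        ≡⟨ triple L ⟩
  L + L * 2                                        ∎
  where
  open ≡-Reasoning

  regroup : ∀ a b c i j k → a + b + c + (i + j + k) ≡ (a + i) + (b + j) + (c + k)
  regroup = solve-∀

  triple : ∀ L → L + L + L ≡ L + L * 2
  triple = solve-∀

theorem4p2 : (i j k : ℕ) → let L = ⌈ i + j + k /2⌉ in
    D₁₈ i j k ≡ L →
    ∃ λ f → HasCardinality (ShortestPaths origin (+ i , + j , + k)) f ×
    (2 ∣ i + j + k → + f / 1 ≡ evenFormula L i j k) ×
    (¬ (2 ∣ i + j + k) → + f / 1 ≡ oddFormula L i j k)
theorem4p2 i j k D≡L =
  length (words L t) ,
  shortestPaths-cardinality i≤L j≤L k≤L tight (proj₂ (length*≢0⇒∃∈ (words L t) scaledCount≢0)) ,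
  (λ 2∣s → /1≡/ (length (words L t)) (L !) (denominator L i j k) {{denominator≢0 L i j k}} (even 2∣s)) ,
  (λ 2∤s → /1≡/ (length (words L t)) (L ! * pairs t) (denominator L i j k) {{denominator≢0 L i j k}} (odd 2∤s))
  where
  s L : ℕ
  s = i + j + k
  L = ⌈ s /2⌉

  t : Tally
  t = L ∸ i , L ∸ j , L ∸ k

  -- `D₁₈ i j k` is the maximum of `i`, `j`, `k` and `L`, so its equality with `L` bounds each
  -- coordinate.
  ij≤L : i ℕ.⊔ j ≤ L
  ij≤L = ≤-trans (m≤m⊔n (i ℕ.⊔ j) k) (≤-trans (m≤m⊔n (i ℕ.⊔ j ℕ.⊔ k) L) (≤-reflexive D≡L))

  i≤L : i ≤ L
  i≤L = m⊔n≤o⇒m≤o i j ij≤L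

  j≤L : j ≤ L
  j≤L = m⊔n≤o⇒n≤o i j ij≤L

  k≤L : k ≤ L
  k≤L = ≤-trans (m≤n⊔m (i ℕ.⊔ j) k) (≤-trans (m≤m⊔n (i ℕ.⊔ j ℕ.⊔ k) L) (≤-reflexive D≡L))

  size-t : size t + s ≡ L + L * 2
  size-t = size-complement i≤L j≤L k≤L

  size-even : 2 ∣ s → size t ≡ L
  size-even 2∣s = +-cancelʳ-≡ s _ _ (trans size-t (cong (_+_ L) (⌈n/2⌉*2-even s 2∣s)))

  size-odd : ¬ 2 ∣ s → size t ≡ suc L
  size-odd 2∤s = +-cancelʳ-≡ s _ _ (trans size-t (trans (cong (_+_ L) (⌈n/2⌉*2-odd s 2∤s)) (+-suc L s)))

  even : 2 ∣ s → scaledCount L t ≡ L !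
  even 2∣s = scaledCount-exact L t (size-even 2∣s)

  odd : ¬ 2 ∣ s → scaledCount L t ≡ L ! * pairs t
  odd 2∤s = scaledCount-excess L t (size-odd 2∤s)

  tight : L * 2 ≤ suc s
  tight with 2 ∣? s
  ... | yes 2∣s = ≤-trans (≤-reflexive (⌈n/2⌉*2-even s 2∣s)) (n≤1+n s)
  ... | no 2∤s  = ≤-reflexive (⌈n/2⌉*2-odd s 2∤s)

  -- Since the count is positive, some word has tally `t`, which provides a path of length `L`.
  scaledCount≢0 : scaledCount L t ≢ 0
  scaledCount≢0 ≡0 with 2 ∣? s
  ... | yes 2∣s = ≢-nonZero⁻¹ (L !) {{L !≢0}} (trans (sym (even 2∣s)) ≡0)
  ... | no 2∤s  with m*n≡0⇒m≡0∨n≡0 (L !) (trans (sym (odd 2∤s)) ≡0)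
  ...   | inj₁ L!≡0    = ≢-nonZero⁻¹ (L !) {{L !≢0}} L!≡0
  ...   | inj₂ pairs≡0 =
    pairs≢0 (L ∸ i) (L ∸ j) (L ∸ k) (m∸n≤m L i) (m∸n≤m L j) (m∸n≤m L k) (size-odd 2∤s) pairs≡0
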